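{- Let $(a_i)_{i\in\mathbb{Z}}$ be the quiddity row of an infinite frieze $\mathcal{F}=(m_{ij})_{j-i\ge-2}$. Then, for all $j\ge i$: a) $\displaystyle a_j=\frac{m_{ij}+m_{i,j-2}}{m_{i,j-1}}$ and $\displaystyle a_i=\frac{m_{ij}+m_{i+2,j}}{m_{i+1,j}}$; b) $\displaystyle m_{ij}=\det\begin{pmatrix}a_i&1&&&0\\ 1&a_{i+1}&1&&\\ &\ddots&\ddots&\ddots&\\ &&1&a_{j-1}&1\\ 0&&&1&a_j\end{pmatrix}$, the determinant of the tridiagonal $(j-i+1)\times(j-i+1)$ matrix with diagonal entries $a_i,a_{i+1},\dots,a_j$, all entries directly above and below the diagonal equal to $1$, and all other entries $0$.
   Context: An infinite frieze is an array $(m_{ij})_{i,j\in\mathbb{Z},\,j-i\ge -2}$ of integers with $m_{i,i-2}=0$ and $m_{i,i-1}=1$ for all $i\in\mathbb{Z}$, $m_{ij}>0$ for all $j\ge i$, and $m_{ij}m_{i+1,j+1}-m_{i+1,j}m_{i,j+1}=1$ for all $j-i\ge -1$. Its quiddity row is the sequence $(a_i)_{i\in\mathbb{Z}}$ with $a_i=m_{ii}$. -}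

module Defs where

open import Data.Nat.Base as ℕ using (ℕ; zero; suc; ∣_-_∣)
open import Data.Integer.Base as ℤ
  using (ℤ; +_; +[1+_]; 0ℤ; 1ℤ; -1ℤ; _+_; _-_; _*_; _^_; _≤_; _≥_; _>_)
import Data.Integer.Properties as ℤ
open import Data.Rational.Base as ℚ using (ℚ; _/_)
import Data.Rational.Properties as ℚ
open import Data.Fin.Base using (Fin; zero; suc; toℕ)
open import Data.Vec.Functional using (Vector; removeAt)
open import Algebra.Properties.CommutativeMonoid.Sum ℤ.+-0-commutativeMonoid using (sum)
open import Relation.Nullary using (yes; no)
open import Relation.Binary.PropositionalEquality

-- The array is given by a total function m; no condition involves its values
-- at positions with j - i < -2, which are arbitrary and carry no meaning.
record InfiniteFrieze : Set where
  field
    m          : ℤ → ℤ → ℤ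
    zero-row   : ∀ i → m i (i - + 2) ≡ 0ℤ
    one-row    : ∀ i → m i (i - + 1) ≡ 1ℤ
    positive   : ∀ i j → j ≥ i → m i j > 0ℤ
    unimodular : ∀ i j → j - i ≥ -1ℤ →
      m i j * m (i + + 1) (j + + 1) - m (i + + 1) j * m i (j + + 1) ≡ 1ℤ

  quiddity : ℤ → ℤ
  quiddity i = m i i

Matrix : ℕ → Set
Matrix n = Vector (Vector ℤ n) n

-- Laplace expansion along the first row.
det : ∀ {n} → Matrix n → ℤ
det {zero}  A = 1ℤ
det {suc n} A =
  sum λ k → -1ℤ ^ toℕ k * A zero k * det (λ p → removeAt (A (suc p)) k)

-- Rows and columns are numbered from 0, so the diagonal is a i , a (i + 1) , ….
tridiagonal : (ℤ → ℤ) → ℤ → (n : ℕ) → Matrix n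
tridiagonal a i n p q with ∣ toℕ p - toℕ q ∣
... | 0 = a (i + + toℕ p)
... | 1 = 1ℤ
... | _ = 0ℤ

ι : ℤ → ℚ
ι z = z / 1

ι-nonZero : ∀ {z} → z > 0ℤ → ℚ.NonZero (ι z)
ι-nonZero {+[1+ n ]} _ =
  ℚ.pos⇒nonZero (ι +[1+ n ]) {{ℚ.normalize-pos (suc n) 1}}
ι-nonZero {+ zero} (ℤ.+<+ ())

module _ (F : InfiniteFrieze) {i j : ℤ} (j≥i : j ≥ i) where
  open InfiniteFrieze F

  m[i,j-1]-nonZero : ℚ.NonZero (ι (m i (j - + 1)))
  m[i,j-1]-nonZero = ι-nonZero pos
    where
    pos : m i (j - + 1) > 0ℤ
    pos with i ℤ.≟ j
    ... | yes refl = subst (_> 0ℤ) (sym (one-row i)) (ℤ.+<+ (ℕ.s≤s ℕ.z≤n))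
    ... | no i≢j   = positive i (j - + 1)
      (subst (i ≤_) (ℤ.+-comm -1ℤ j) (ℤ.i<j⇒i≤pred[j] (ℤ.≤∧≢⇒< j≥i i≢j)))

  m[i+1,j]-nonZero : ℚ.NonZero (ι (m (i + + 1) j))
  m[i+1,j]-nonZero = ι-nonZero pos
    where
    i+1-1≡i : i + + 1 - + 1 ≡ i
    i+1-1≡i = trans (ℤ.+-assoc i (+ 1) -1ℤ) (ℤ.+-identityʳ i)

    pos : m (i + + 1) j > 0ℤ
    pos with i ℤ.≟ j
    ... | yes refl = subst (_> 0ℤ)
      (trans (sym (one-row (i + + 1))) (cong (m (i + + 1)) i+1-1≡i))
      (ℤ.+<+ (ℕ.s≤s ℕ.z≤n))
    ... | no i≢j   = positive (i + + 1) j
      (subst (_≤ j) (ℤ.+-comm 1ℤ i) (ℤ.i<j⇒suc[i]≤j (ℤ.≤∧≢⇒< j≥i i≢j)))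

{-# OPTIONS --safe #-}

-- Subtracting the unimodular relations of two adjacent diamonds and cancelling
-- a positive common entry propagates the three-term recurrences (a) along the
-- diagonals of the frieze, starting from the rows of zeros and ones.  Expanding
-- the tridiagonal determinant shows that it obeys the second recurrence of (a)
-- with the same initial values.
module Submission where

open import Defs
open import Data.Nat.Base using (ℕ; zero; suc; z<s)
import Data.Nat.Base as ℕ
open import Data.Integer.Base
  using (ℤ; +_; -[1+_]; 0ℤ; 1ℤ; -1ℤ; _+_; _-_; _*_; -_; _^_; _≥_; _>_; ∣_∣; NonZero;
   >-nonZero; +<+)
import Data.Integer.Properties as ℤ
open import Data.Integer.Tactic.RingSolver using (solve-∀)
open import Data.Rational.Base as ℚ using (_÷_)
import Data.Rational.Properties as ℚ
import Data.Rational.Unnormalised.Base as ℚᵘ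
import Data.Rational.Unnormalised.Properties as ℚᵘ
open import Data.Fin.Base using (Fin; zero; suc; toℕ; punchIn)
open import Data.Vec.Functional using (removeAt)
open import Algebra.Properties.CommutativeMonoid.Sum ℤ.+-0-commutativeMonoid
  using (sum; sum-cong-≗; sum-replicate-zero)
open import Data.Product.Base using (_×_; _,_)
open import Function.Base using (_∘_)
open import Relation.Binary.PropositionalEquality

-- Passing from integer identities to rational quotients.

ι-* : ∀ x y → ι (x * y) ≡ ι x ℚ.* ι y
ι-* x y = ℚ.toℚᵘ-injective (begin
  ℚ.toℚᵘ (ι (x * y))                  ≈⟨ ℚ.toℚᵘ-fromℚᵘ (x * y ℚᵘ./ 1) ⟩
  -- Without normalisation, this product of fractions over 1 computes to `x * y` over 1.
  (x ℚᵘ./ 1) ℚᵘ.* (y ℚᵘ./ 1)          ≈⟨ ℚᵘ.*-cong (ℚ.toℚᵘ-fromℚᵘ (x ℚᵘ./ 1)) (ℚ.toℚᵘ-fromℚᵘ (y ℚᵘ./ 1)) ⟨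
  ℚ.toℚᵘ (ι x) ℚᵘ.* ℚ.toℚᵘ (ι y)      ≈⟨ ℚ.toℚᵘ-homo-* (ι x) (ι y) ⟨
  ℚ.toℚᵘ (ι x ℚ.* ι y)                ∎)
  where open ℚᵘ.≃-Reasoning

-- The recurrences are proved without division in ℤ; this turns them into the quotients of (a).
ι-÷ : ∀ x {y} z .{{_ : ℚ.NonZero (ι z)}} → y ≡ x * z → ι x ≡ ι y ÷ ι z
ι-÷ x z refl = sym (begin
  ι (x * z) ℚ.* ℚ.1/ ι z        ≡⟨ cong (ℚ._* (ℚ.1/ ι z)) (ι-* x z) ⟩
  ι x ℚ.* ι z ℚ.* ℚ.1/ ι z      ≡⟨ ℚ.*-assoc (ι x) (ι z) (ℚ.1/ ι z) ⟩
  ι x ℚ.* (ι z ℚ.* ℚ.1/ ι z)    ≡⟨ cong (ι x ℚ.*_) (ℚ.*-inverseʳ (ι z)) ⟩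
  ι x ℚ.* ℚ.1ℚ                  ≡⟨ ℚ.*-identityʳ (ι x) ⟩
  ι x                           ∎)
  where open ≡-Reasoning

-- Laplace expansion of matrices with a sparse first column.

sum-zero : ∀ {n} (f : Fin n → ℤ) → (∀ k → f k ≡ 0ℤ) → sum f ≡ 0ℤ
sum-zero {n} f f≗0 = trans (sum-cong-≗ f≗0) (sum-replicate-zero n)

minor : ∀ {n} → Matrix (suc n) → Fin (suc n) → Matrix n
minor A k p = removeAt (A (suc p)) k

-- Definitionally the summand in `det`, so `det A` unfolds to `sum (laplaceTerm A)`.
laplaceTerm : ∀ {n} → Matrix (suc n) → Fin (suc n) → ℤ
laplaceTerm A k = -1ℤ ^ toℕ k * A zero k * det (minor A k)

laplaceTerm-zeroEntry : ∀ {n} (A : Matrix (suc n)) k → A zero k ≡ 0ℤ → laplaceTerm A k ≡ 0ℤ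
laplaceTerm-zeroEntry A k A₀ₖ≡0 = begin
  -1ℤ ^ toℕ k * A zero k * det (minor A k)    ≡⟨ cong (λ x → -1ℤ ^ toℕ k * x * det (minor A k)) A₀ₖ≡0 ⟩
  -1ℤ ^ toℕ k * 0ℤ * det (minor A k)          ≡⟨ cong (_* det (minor A k)) (ℤ.*-zeroʳ (-1ℤ ^ toℕ k)) ⟩
  0ℤ * det (minor A k)                        ≡⟨ ℤ.*-zeroˡ (det (minor A k)) ⟩
  0ℤ                                          ∎
  where open ≡-Reasoning

laplaceTerm-zeroMinor : ∀ {n} (A : Matrix (suc n)) k → det (minor A k) ≡ 0ℤ → laplaceTerm A k ≡ 0ℤ
laplaceTerm-zeroMinor A k detM≡0 =
  trans (cong (-1ℤ ^ toℕ k * A zero k *_) detM≡0) (ℤ.*-zeroʳ (-1ℤ ^ toℕ k * A zero k))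

det-cong : ∀ {n} {A B : Matrix n} → (∀ p q → A p q ≡ B p q) → det A ≡ det B
det-cong {zero}  A≗B = refl
det-cong {suc n} A≗B = sum-cong-≗ λ k →
  cong₂ (λ x y → -1ℤ ^ toℕ k * x * y) (A≗B zero k)
    (det-cong λ p q → A≗B (suc p) (punchIn k q))

-- Induction on the size: the term at column 0 has a zero entry, and every other minor keeps a zero
-- first column.
det-zeroColumn : ∀ {n} (A : Matrix (suc n)) → (∀ p → A p zero ≡ 0ℤ) → det A ≡ 0ℤ
det-zeroColumn A A₋₀≡0 = sum-zero (laplaceTerm A) λ
  { zero            → laplaceTerm-zeroEntry A zero (A₋₀≡0 zero)
  -- Splitting `k` once more exposes the size of the minor as a successor, so that it has a first
  -- column.
  ; k@(suc zero)    → laplaceTerm-zeroMinor A k (det-zeroColumn (minor A k) (A₋₀≡0 ∘ suc))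
  ; k@(suc (suc _)) → laplaceTerm-zeroMinor A k (det-zeroColumn (minor A k) (A₋₀≡0 ∘ suc))
  }

-- Every minor except the one at column 0 inherits a zero first column, so only the leading term
-- survives.
det-unitColumn : ∀ {n} (A : Matrix (suc n)) → A zero zero ≡ 1ℤ →
  (∀ p → A (suc p) zero ≡ 0ℤ) → det A ≡ det (minor A zero)
det-unitColumn {n} A A₀₀≡1 A₊₀≡0 = begin
  laplaceTerm A zero + sum (laplaceTerm A ∘ suc)
    ≡⟨ cong₂ _+_ (cong (λ x → 1ℤ * x * det (minor A zero)) A₀₀≡1) (sum-zero (laplaceTerm A ∘ suc) rest) ⟩
  1ℤ * det (minor A zero) + 0ℤ
    ≡⟨ ℤ.+-identityʳ (1ℤ * det (minor A zero)) ⟩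
  1ℤ * det (minor A zero)
    ≡⟨ ℤ.*-identityˡ (det (minor A zero)) ⟩
  det (minor A zero)
    ∎
  where
  open ≡-Reasoning
  rest : ∀ k → laplaceTerm A (suc k) ≡ 0ℤ
  rest zero      = laplaceTerm-zeroMinor A (suc zero) (det-zeroColumn (minor A (suc zero)) A₊₀≡0)
  rest k@(suc _) = laplaceTerm-zeroMinor A (suc k) (det-zeroColumn (minor A (suc k)) A₊₀≡0)

-- The three-term recurrence of tridiagonal determinants.

tridiagonal-suc : ∀ a i n p q →
  tridiagonal a i (suc n) (suc p) (suc q) ≡ tridiagonal a (i + + 1) n p q
tridiagonal-suc a i n p q with ℕ.∣ toℕ p - toℕ q ∣
... | 0           = cong a (sym (ℤ.+-assoc i (+ 1) (+ toℕ p)))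
... | 1           = refl
... | suc (suc _) = refl

-- The first row has only the entries `a i` and 1. The minor at the 1 has first column 1, 0, ..., 0,
-- so it reduces to the block two steps down the diagonal.
det-tridiagonal : ∀ a i n →
  det (tridiagonal a i (suc (suc n))) ≡
  a i * det (tridiagonal a (i + + 1) (suc n)) - det (tridiagonal a (i + + 2) n)
det-tridiagonal a i n = begin
  laplaceTerm A zero + (laplaceTerm A (suc zero) + sum rest)
    ≡⟨ cong₂ (λ x y → x + (-1ℤ * det (minor A (suc zero)) + y))
         (cong₂ (λ x y → 1ℤ * a x * y) (ℤ.+-identityʳ i) (det-cong (tridiagonal-suc a i (suc n))))
         (sum-zero rest λ k → laplaceTerm-zeroEntry A (suc (suc k)) refl) ⟩
  1ℤ * a i * D + (-1ℤ * det (minor A (suc zero)) + 0ℤ)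
    ≡⟨ cong (λ x → 1ℤ * a i * D + (-1ℤ * x + 0ℤ))
         (trans (det-unitColumn (minor A (suc zero)) refl (λ _ → refl)) (det-cong twice)) ⟩
  1ℤ * a i * D + (-1ℤ * D′ + 0ℤ)
    ≡⟨ simplify (a i) D D′ ⟩
  a i * D - D′
    ∎
  where
  open ≡-Reasoning
  A  = tridiagonal a i (suc (suc n))
  rest : Fin n → ℤ
  rest k = laplaceTerm A (suc (suc k))
  D  = det (tridiagonal a (i + + 1) (suc n))
  D′ = det (tridiagonal a (i + + 2) n)

  twice : ∀ p q → A (suc (suc p)) (suc (suc q)) ≡ tridiagonal a (i + + 2) n p q
  twice p q = begin
    A (suc (suc p)) (suc (suc q))                      ≡⟨ tridiagonal-suc a i (suc n) (suc p) (suc q) ⟩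
    tridiagonal a (i + + 1) (suc n) (suc p) (suc q)    ≡⟨ tridiagonal-suc a (i + + 1) n p q ⟩
    tridiagonal a (i + + 1 + + 1) n p q                ≡⟨ cong (λ x → tridiagonal a x n p q) (ℤ.+-assoc i (+ 1) (+ 1)) ⟩
    tridiagonal a (i + + 2) n p q                      ∎

  simplify : ∀ x y z → 1ℤ * x * y + (-1ℤ * z + 0ℤ) ≡ x * y + - z
  simplify = solve-∀

-- The two unimodular relations describe adjacent diamonds sharing `q` and `r`. Their difference is
-- `r * (s + t) ≡ q * (p + u)`, so the factor `c` carries over from one side to the other once `r`
-- is cancelled.
cross-cancel : ∀ p q r s t u c .{{_ : NonZero r}} →
  p * q - r * s ≡ 1ℤ → r * t - u * q ≡ 1ℤ → p + u ≡ c * r → s + t ≡ c * q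
cross-cancel p q r s t u c eq₁ eq₂ eq₃ = ℤ.*-cancelˡ-≡ r (s + t) (c * q) (begin
  r * (s + t)                                ≡⟨ expand p q r s t u ⟩
  q * (p + u) + ((r * t + - (u * q)) + - (p * q + - (r * s)))
                                             -- Both relations have value 1, and `1ℤ - 1ℤ` computes
                                             -- to `0ℤ`.
                                             ≡⟨ cong₂ (λ x y → q * (p + u) + (x - y)) eq₂ eq₁ ⟩
  q * (p + u) + 0ℤ                           ≡⟨ cong (λ x → q * x + 0ℤ) eq₃ ⟩
  q * (c * r) + 0ℤ                           ≡⟨ collect q c r ⟩
  r * (c * q)                                ∎)
  where
  open ≡-Reasoning
  expand : ∀ p q r s t u →
    r * (s + t) ≡ q * (p + u) + ((r * t + - (u * q)) + - (p * q + - (r * s)))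
  expand = solve-∀
  collect : ∀ q c r → q * (c * r) + 0ℤ ≡ r * (c * q)
  collect = solve-∀

-- Recurrences along the diagonals of a frieze.

module _ (F : InfiniteFrieze) where
  open InfiniteFrieze F
  open ≡-Reasoning

  -- The diagonals of the frieze, numbered from 0 at the row of zeros.
  e : ℤ → ℕ → ℤ
  e i n = m i (i + + n - + 2)

  e-zero : ∀ i → e i 0 ≡ 0ℤ
  e-zero i = trans (cong (λ x → m i (x - + 2)) (ℤ.+-identityʳ i)) (zero-row i)

  e-one : ∀ i → e i 1 ≡ 1ℤ
  e-one i = trans (cong (m i) (ℤ.+-assoc i (+ 1) (- + 2))) (one-row i)

  e-two : ∀ i → e i 2 ≡ quiddity i
  e-two i = cong (m i) (trans (ℤ.+-assoc i (+ 2) (- + 2)) (ℤ.+-identityʳ i))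

  e-positive : ∀ i n → e i (suc n) > 0ℤ
  e-positive i zero    = subst (_> 0ℤ) (sym (e-one i)) (+<+ z<s)
  e-positive i (suc n) = subst (λ j → m i j > 0ℤ) (eq i (+ n)) (positive i (i + + n) (ℤ.i≤i+j i (+ n)))
    where
    -- `-[1+ 1 ]` is what `- + 2` computes to.
    eq : ∀ i n → i + n ≡ i + (+ 2 + n) + -[1+ 1 ]
    eq = solve-∀

  e-unimodular : ∀ i n → e i (suc n) * e (i + + 1) (suc n) - e (i + + 1) n * e i (suc (suc n)) ≡ 1ℤ
  e-unimodular i n = begin
    e i (suc n) * e (i + + 1) (suc n) - e (i + + 1) n * e i (suc (suc n))
      ≡⟨ cong₂ _-_
           (cong₂ _*_ (cong (m i) (eq₁ i (+ n))) (cong (m (i + + 1)) (eq₂ i (+ n))))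
           (cong₂ _*_ (cong (m (i + + 1)) (eq₃ i (+ n))) (cong (m i) (eq₄ i (+ n)))) ⟩
    m i j * m (i + + 1) (j + + 1) - m (i + + 1) j * m i (j + + 1)
      ≡⟨ unimodular i j (subst (_≥ -1ℤ) (eq₅ i (+ n)) (ℤ.i≤i+j -1ℤ (+ n))) ⟩
    1ℤ
      ∎
    where
    -- Here `j - i` is `n - 1`, so `n = 0` meets the bound -1 exactly.
    j = i + + n + -1ℤ
    eq₁ : ∀ i n → i + (+ 1 + n) + -[1+ 1 ] ≡ i + n + -1ℤ
    eq₁ = solve-∀
    eq₂ : ∀ i n → i + + 1 + (+ 1 + n) + -[1+ 1 ] ≡ i + n + -1ℤ + + 1
    eq₂ = solve-∀
    eq₃ : ∀ i n → i + + 1 + n + -[1+ 1 ] ≡ i + n + -1ℤ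
    eq₃ = solve-∀
    eq₄ : ∀ i n → i + (+ 2 + n) + -[1+ 1 ] ≡ i + n + -1ℤ + + 1
    eq₄ = solve-∀
    eq₅ : ∀ i n → -1ℤ + n ≡ i + n + -1ℤ + - i
    eq₅ = solve-∀

  -- Induction on `n` for all `i` at once: passing from `(i + 1, n)` to `(i, n + 1)` keeps the end
  -- `i + n + 1` fixed, hence also the coefficient. The two diamonds lie side by side between the
  -- diagonals `i` and `i + 1`.
  column-recurrence : ∀ i n → e i (suc (suc n)) + e i n ≡ quiddity (i + + n) * e i (suc n)
  column-recurrence i zero = begin
    e i 2 + e i 0                     ≡⟨ cong₂ _+_ (e-two i) (e-zero i) ⟩
    quiddity i + 0ℤ                   ≡⟨ ℤ.+-identityʳ (quiddity i) ⟩
    quiddity i                        ≡⟨ cong quiddity (ℤ.+-identityʳ i) ⟨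
    quiddity (i + + 0)                ≡⟨ ℤ.*-identityʳ (quiddity (i + + 0)) ⟨
    quiddity (i + + 0) * 1ℤ           ≡⟨ cong (quiddity (i + + 0) *_) (e-one i) ⟨
    quiddity (i + + 0) * e i 1        ∎
  column-recurrence i (suc n) =
    cross-cancel (e (i + + 1) (suc (suc n))) (e i (suc (suc n))) (e (i + + 1) (suc n))
      (e i (suc (suc (suc n)))) (e i (suc n)) (e (i + + 1) n) (quiddity (i + + suc n))
      {{>-nonZero (e-positive (i + + 1) n)}}
      (trans (cong (_- e (i + + 1) (suc n) * e i (suc (suc (suc n))))
               (ℤ.*-comm (e (i + + 1) (suc (suc n))) (e i (suc (suc n)))))
        (e-unimodular i (suc n)))
      (trans (cong (_- e (i + + 1) n * e i (suc (suc n))) (ℤ.*-comm (e (i + + 1) (suc n)) (e i (suc n))))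
        (e-unimodular i n))
      (trans (column-recurrence (i + + 1) n)
        (cong (λ x → quiddity x * e (i + + 1) (suc n)) (ℤ.+-assoc i (+ 1) (+ n))))

  -- Induction on `n` with `i`, and so the coefficient, fixed. One diamond lies between the
  -- diagonals `i` and `i + 1`, the other between `i + 1` and `i + 2`.
  row-recurrence : ∀ i n → e i (suc (suc n)) + e (i + + 2) n ≡ quiddity i * e (i + + 1) (suc n)
  row-recurrence i zero = begin
    e i 2 + e (i + + 2) 0             ≡⟨ cong₂ _+_ (e-two i) (e-zero (i + + 2)) ⟩
    quiddity i + 0ℤ                   ≡⟨ ℤ.+-identityʳ (quiddity i) ⟩
    quiddity i                        ≡⟨ ℤ.*-identityʳ (quiddity i) ⟨
    quiddity i * 1ℤ                   ≡⟨ cong (quiddity i *_) (e-one (i + + 1)) ⟨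
    quiddity i * e (i + + 1) 1        ∎
  row-recurrence i (suc n) =
    cross-cancel (e i (suc (suc n))) (e (i + + 1) (suc (suc n))) (e (i + + 1) (suc n))
      (e i (suc (suc (suc n)))) (e (i + + 2) (suc n)) (e (i + + 2) n) (quiddity i)
      {{>-nonZero (e-positive (i + + 1) n)}}
      (e-unimodular i (suc n))
      (subst (λ k → e (i + + 1) (suc n) * e k (suc n) - e k n * e (i + + 1) (suc (suc n)) ≡ 1ℤ)
        (ℤ.+-assoc i (+ 1) (+ 1)) (e-unimodular (i + + 1) n))
      (row-recurrence i n)

  -- Both sides obey the same second-order recurrence, hence two base cases; the empty determinant
  -- matches the row of ones.
  e≡det : ∀ i n → e i (suc n) ≡ det (tridiagonal quiddity i n)
  e≡det i zero          = e-one i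
  e≡det i (suc zero)    = begin
    e i 2                                            ≡⟨ e-two i ⟩
    quiddity i                                       ≡⟨ cong quiddity (ℤ.+-identityʳ i) ⟨
    quiddity (i + + 0)                               ≡⟨ simplify (quiddity (i + + 0)) ⟩
    1ℤ * quiddity (i + + 0) * 1ℤ + 0ℤ                ∎
    where
    simplify : ∀ x → x ≡ 1ℤ * x * 1ℤ + 0ℤ
    simplify = solve-∀
  e≡det i (suc (suc n)) = begin
    e i (suc (suc (suc n)))
      ≡⟨ isolate (e i (suc (suc (suc n)))) (e (i + + 2) (suc n)) ⟩
    e i (suc (suc (suc n))) + e (i + + 2) (suc n) - e (i + + 2) (suc n)
      ≡⟨ cong (_- e (i + + 2) (suc n)) (row-recurrence i (suc n)) ⟩
    quiddity i * e (i + + 1) (suc (suc n)) - e (i + + 2) (suc n)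
      ≡⟨ cong₂ (λ x y → quiddity i * x - y) (e≡det (i + + 1) (suc n)) (e≡det (i + + 2) n) ⟩
    quiddity i * det (tridiagonal quiddity (i + + 1) (suc n)) - det (tridiagonal quiddity (i + + 2) n)
      ≡⟨ det-tridiagonal quiddity i n ⟨
    det (tridiagonal quiddity i (suc (suc n)))
      ∎
    where
    isolate : ∀ x y → x ≡ x + y + - y
    isolate = solve-∀

lemma1p7 : (F : InfiniteFrieze) →
    let open InfiniteFrieze F using (m)
        a = InfiniteFrieze.quiddity F in
    (i j : ℤ) (j≥i : j ≥ i) →
      (ι (a j) ≡ _÷_ (ι (m i j + m i (j - + 2))) (ι (m i (j - + 1))) {{m[i,j-1]-nonZero F j≥i}})
      × (ι (a i) ≡ _÷_ (ι (m i j + m (i + + 2) j)) (ι (m (i + + 1) j)) {{m[i+1,j]-nonZero F j≥i}})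
      × (m i j ≡ det (tridiagonal a i (suc ∣ j - i ∣)))
lemma1p7 F i j j≥i =
    ι-÷ (a j) (m i (j - + 1)) {{m[i,j-1]-nonZero F j≥i}} (begin
      m i j + m i (j - + 2)                     ≡⟨ cong₂ _+_ mᵢⱼ (cong (λ x → m i (x - + 2)) j≡i+n) ⟩
      e F i (suc (suc n)) + e F i n             ≡⟨ column-recurrence F i n ⟩
      a (i + + n) * e F i (suc n)               ≡⟨ cong₂ (λ x y → a x * y) j≡i+n mᵢ,ⱼ₋₁ ⟨
      a j * m i (j - + 1)                       ∎)
  , ι-÷ (a i) (m (i + + 1) j) {{m[i+1,j]-nonZero F j≥i}} (begin
      m i j + m (i + + 2) j                     ≡⟨ cong₂ _+_ mᵢⱼ mᵢ₊₂,ⱼ ⟩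
      e F i (suc (suc n)) + e F (i + + 2) n     ≡⟨ row-recurrence F i n ⟩
      a i * e F (i + + 1) (suc n)               ≡⟨ cong (a i *_) mᵢ₊₁,ⱼ ⟨
      a i * m (i + + 1) j                       ∎)
  -- `e` counts from the row of zeros, so index `n + 2` matches a matrix of size `n + 1`.
  , trans mᵢⱼ (e≡det F i (suc n))
  where
  open InfiniteFrieze F using (m) renaming (quiddity to a)
  open ≡-Reasoning
  n = ∣ j - i ∣

  -- Since `j ≥ i`, the absolute value in `n` is `j - i` itself; the entries of the theorem thus
  -- become entries of `e`.
  j≡i+n : j ≡ i + + n
  j≡i+n = trans (cancel i j) (cong (λ x → i + x) (sym (ℤ.0≤i⇒+∣i∣≡i (ℤ.i≤j⇒0≤j-i j≥i))))
    where
    cancel : ∀ i j → j ≡ i + (j + - i)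
    cancel = solve-∀

  mᵢⱼ : m i j ≡ e F i (suc (suc n))
  mᵢⱼ = cong (m i) (trans j≡i+n (eq i (+ n)))
    where
    eq : ∀ i n → i + n ≡ i + (+ 2 + n) + -[1+ 1 ]
    eq = solve-∀

  mᵢ,ⱼ₋₁ : m i (j - + 1) ≡ e F i (suc n)
  mᵢ,ⱼ₋₁ = cong (m i) (trans (cong (_- + 1) j≡i+n) (eq i (+ n)))
    where
    eq : ∀ i n → i + n + -1ℤ ≡ i + (+ 1 + n) + -[1+ 1 ]
    eq = solve-∀

  mᵢ₊₁,ⱼ : m (i + + 1) j ≡ e F (i + + 1) (suc n)
  mᵢ₊₁,ⱼ = cong (m (i + + 1)) (trans j≡i+n (eq i (+ n)))
    where
    eq : ∀ i n → i + n ≡ i + + 1 + (+ 1 + n) + -[1+ 1 ]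
    eq = solve-∀

  mᵢ₊₂,ⱼ : m (i + + 2) j ≡ e F (i + + 2) n
  mᵢ₊₂,ⱼ = cong (m (i + + 2)) (trans j≡i+n (eq i (+ n)))
    where
    eq : ∀ i n → i + n ≡ i + + 2 + n + -[1+ 1 ]
    eq = solve-∀
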